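{- For every set $\Delta\subseteq\mathcal{A}$ there is a finite subset $\Delta'\subseteq\mathcal{A}$ such that $\Delta'$ is an antichain (in the partially ordered set $\langle\mathcal{A},\preceq\rangle$) and $\mathcal{F}(\Delta)=\mathcal{F}(\Delta')$.
   Context: Fix an infinite countable set $\mathit{At}$ of propositional variables (atoms). A (disjunctive) program is a collection of rules of the form $r = a_1|\ldots|a_k\leftarrow b_1,\ldots,b_m,\mathit{not}\ c_1,\ldots,\mathit{not}\ c_n$, where all $a_i,b_i,c_i\in \mathit{At}$ (with $k,m,n\geq 0$ integers); $[k,m,n]$ is the arity of $r$. Let $U=\{0,1,2,\ldots\}\cup\{\infty\}$, ordered by the usual $\leq$ with $i\le\infty$ for every $i$, and $\mathcal{A}=\{[k,m,n]\mid k,m,n\in U\}$. For $\alpha\in\mathcal{A}$, $\alpha_1,\alpha_2,\alpha_3$ denote its components. For $\alpha,\beta\in\mathcal{A}$, $\alpha\preceq\beta$ means: $\alpha_i\le\beta_i$ for $i=1,2,3$, and if $\alpha_1=0$ then $\beta_1=0$. $\mathcal{F}(\Delta)$ is the set of all finite programs $P$ such that for every rule $r\in P$ there is $\alpha\in\Delta$ with $\alpha_r\preceq\alpha$, where $\alpha_r$ is the arity of $r$. -}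

module Defs where

open import Data.List.Base using (List; length)
open import Data.List.Membership.Propositional using (_∈_)
open import Data.Nat.Base using (ℕ; _≤_)
open import Data.Nat.Properties using (≤-trans; ≤-reflexive; ≤-antisym)
open import Data.Product using (_×_; _,_; ∃)
open import Function.Base using (_∘_)
open import Level using (Level; 0ℓ; _⊔_)
open import Relation.Binary.Bundles using (Poset)
open import Relation.Binary.Construct.Add.Supremum.NonStrict _≤_
  using (_≤⁺_; ≤⁺-trans; ≤⁺-reflexive-≡; ≤⁺-antisym-≡)
open import Relation.Binary.Structures using (IsPartialOrder)
open import Relation.Binary.PropositionalEquality
  using (_≡_; refl; isEquivalence)
open import Relation.Nullary.Construct.Add.Supremum using (_⁺; [_])
open import Relation.Unary using (Pred; _≐_)

private
  variable
    a c ℓ ℓ₁ ℓ₂ : Level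

IsFiniteSet : {A : Set a} → Pred A ℓ → Set (a ⊔ ℓ)
IsFiniteSet P = ∃ λ xs → P ≐ (_∈ xs)

IsAntichain : (O : Poset c ℓ₁ ℓ₂) → Pred (Poset.Carrier O) ℓ →
              Set (c ⊔ ℓ₁ ⊔ ℓ₂ ⊔ ℓ)
IsAntichain O P = ∀ {x y} → P x → P y → x ≤ₒ y → x ≈ₒ y
  where open Poset O renaming (_≤_ to _≤ₒ_; _≈_ to _≈ₒ_)

-- U = {0, 1, 2, …} ∪ {∞}: the number n is [ n ], and ∞ is ⊤⁺.
U : Set
U = ℕ ⁺

record 𝓐 : Set where
  constructor ⟦_,_,_⟧
  field
    α₁ α₂ α₃ : U

open 𝓐 public

infix 4 _≼_

record _≼_ (α β : 𝓐) : Set where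
  field
    ≤₁  : α₁ α ≤⁺ α₁ β
    ≤₂  : α₂ α ≤⁺ α₂ β
    ≤₃  : α₃ α ≤⁺ α₃ β
    0⇒0 : α₁ α ≡ [ 0 ] → α₁ β ≡ [ 0 ]

≼-isPartialOrder : IsPartialOrder _≡_ _≼_
≼-isPartialOrder = record
  { isPreorder = record
    { isEquivalence = isEquivalence
    ; reflexive     = reflexive
    ; trans         = transitive
    }
  ; antisym = antisym
  }
  where
  open _≼_

  ≤⁺-refl : ∀ {u} → u ≤⁺ u
  ≤⁺-refl = ≤⁺-reflexive-≡ ≤-reflexive refl

  reflexive : ∀ {α β} → α ≡ β → α ≼ β
  reflexive refl = record
    { ≤₁ = ≤⁺-refl ; ≤₂ = ≤⁺-refl ; ≤₃ = ≤⁺-refl ; 0⇒0 = λ eq → eq }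

  transitive : ∀ {α β γ} → α ≼ β → β ≼ γ → α ≼ γ
  transitive p q = record
    { ≤₁  = ≤⁺-trans ≤-trans (≤₁ p) (≤₁ q)
    ; ≤₂  = ≤⁺-trans ≤-trans (≤₂ p) (≤₂ q)
    ; ≤₃  = ≤⁺-trans ≤-trans (≤₃ p) (≤₃ q)
    ; 0⇒0 = 0⇒0 q ∘ 0⇒0 p
    }

  antisym : ∀ {α β} → α ≼ β → β ≼ α → α ≡ β
  antisym p q
    with refl ← ≤⁺-antisym-≡ ≤-antisym (≤₁ p) (≤₁ q)
       | refl ← ≤⁺-antisym-≡ ≤-antisym (≤₂ p) (≤₂ q)
       | refl ← ≤⁺-antisym-≡ ≤-antisym (≤₃ p) (≤₃ q)
    = refl

≼-poset : Poset 0ℓ 0ℓ 0ℓ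
≼-poset = record { isPartialOrder = ≼-isPartialOrder }

module _ (At : Set) where

  -- a₁ | … | aₖ ← b₁ , … , bₘ , not c₁ , … , not cₙ
  record Rule : Set where
    constructor rule
    field
      as bs cs : List At

  Program : Set₁
  Program = Pred Rule 0ℓ

module _ {At : Set} where

  arity : Rule At → 𝓐
  arity (rule as bs cs) = ⟦ [ length as ] , [ length bs ] , [ length cs ] ⟧

module _ (At : Set) where

  𝓕 : Pred 𝓐 ℓ → Pred (Program At) ℓ
  𝓕 Δ P = IsFiniteSet P × (∀ r → P r → ∃ λ α → Δ α × arity r ≼ α)

{-# OPTIONS --safe #-}

-- A down-closed set D ⊆ ℕⁿ is the trace on ℕⁿ of the principal down-sets of
-- finitely many points of Uⁿ, by induction on n.  If D = ℕⁿ, take (∞, …, ∞).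
-- Otherwise fix p ∉ D: every q ∈ D has qᵢ < pᵢ for some i, so D is the union of
-- the finitely many slices qᵢ = j with j < pᵢ, which have one dimension less.
--
-- The arities in the ≼-down-closure of Δ that start with 0 form a down-set of ℕ²,
-- the others one of ℕ³, and ≼ never relates the two kinds.  Of the finite set of
-- points of 𝓐 so obtained, only the maximal ones are kept.
module Submission where

open import Defs
open import Axiom.DoubleNegationElimination using (em⇒dne)
open import Axiom.ExcludedMiddle using (ExcludedMiddle)
open import Data.Fin.Base using (Fin; punchIn)
open import Data.Fin.Patterns using (0F; 1F; 2F)
open import Data.Fin.Properties using (any?)
open import Data.List.Base as List
  using (List; []; _∷_; _++_; applyUpTo; concat; filter; tabulate)
open import Data.List.Membership.Propositional using (_∈_; find; lose)
open import Data.List.Membership.Propositional.Properties using (∈-filter⁻)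
open import Data.List.Relation.Unary.Any using (Any; here; there)
import Data.List.Relation.Unary.Any as Any
open import Data.List.Relation.Unary.Any.Properties
  using (++⁺ˡ; ++⁺ʳ; ++⁻; applyUpTo⁺; applyUpTo⁻; concat⁺; concat⁻;
         filter⁺; filter⁻; lookup-result; map⁺; map⁻; tabulate⁺; tabulate⁻)
open import Data.Nat.Base using (ℕ; zero; suc; _≤_; s≤s; s≤s⁻¹)
open import Data.Nat.Properties using (_<?_; ≤-refl; ≤-trans; ≮⇒≥)
open import Data.Product using (_×_; ∃; _,_; proj₁; proj₂; uncurry)
open import Data.Sum.Base using (inj₁; inj₂; [_,_]′)
open import Data.Vec.Functional using (Vector; fromList; insertAt)
open import Data.Vec.Functional.Properties using (insertAt-lookup; insertAt-punchIn)
open import Data.Vec.Functional.Relation.Binary.Pointwise using (Pointwise)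
open import Function.Base using (_∘_; id)
open import Function.Bundles using (_↔_; _⇔_; mk⇔; Equivalence)
open import Level using (Level; 0ℓ)
open import Relation.Binary.Bundles using (Poset)
open import Relation.Binary.Construct.Add.Supremum.NonStrict _≤_
  using (_≤⁺_; [_]; _≤⊤⁺)
open import Relation.Binary.Definitions using (Decidable)
open import Relation.Binary.PropositionalEquality using (_≡_; refl; sym; subst)
open import Relation.Nullary using (¬_; ¬?; yes; no; contradiction)
open import Relation.Nullary.Construct.Add.Supremum using (⊤⁺; [_])
open import Relation.Unary using (Pred; _≐_)

private
  variable
    c ℓ ℓ₁ ℓ₂ : Level
    n : ℕ

-- Maximal elements of a finite list in a poset.

module _ (O : Poset c ℓ₁ ℓ₂) where
  open Poset O using (Carrier; module Eq)
    renaming (_≤_ to _≤ₒ_; refl to ≤ₒ-refl; trans to ≤ₒ-trans)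

  -- Induction on the list: a new element below a kept one is dropped; otherwise it replaces all
  -- kept ones below it. Neither move changes the down-closure, and `𝓕` depends on nothing more.
  antichain-of-maximal : Decidable _≤ₒ_ → (xs : List Carrier) →
    ∃ λ zs → IsAntichain O (_∈ zs) ×
             (∀ x → Any (x ≤ₒ_) xs ⇔ Any (x ≤ₒ_) zs)
  antichain-of-maximal _≤?_ [] = [] , (λ ()) , λ _ → mk⇔ id id
  antichain-of-maximal _≤?_ (x ∷ xs)
    with zs , anti , xs⇔zs ← antichain-of-maximal _≤?_ xs
    with Any.any? (x ≤?_) zs
  ... | yes x≤zs = zs , anti , λ y → mk⇔
    (λ where
      (here y≤x)   → Any.map (≤ₒ-trans y≤x) x≤zs
      (there y≤xs) → Equivalence.to (xs⇔zs y) y≤xs)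
    (there ∘ Equivalence.from (xs⇔zs y))
  ... | no x≰zs = x ∷ zs′ , anti′ , λ y → mk⇔
    (λ where
      (here y≤x)   → here y≤x
      (there y≤xs) → keep (Equivalence.to (xs⇔zs y) y≤xs))
    (λ where
      (here y≤x)    → here y≤x
      (there y≤zs′) → there (Equivalence.from (xs⇔zs y) (filter⁻ ≰x? y≤zs′)))
    where
    ≰x? = λ z → ¬? (z ≤? x)
    zs′ = filter ≰x? zs

    anti′ : IsAntichain O (_∈ x ∷ zs′)
    anti′ (here refl) (here refl) _   = Eq.refl
    anti′ (here refl) (there v∈)  x≤v =
      contradiction (lose (proj₁ (∈-filter⁻ ≰x? v∈)) x≤v) x≰zs
    anti′ (there u∈)  (here refl) u≤x =
      contradiction u≤x (proj₂ (∈-filter⁻ ≰x? {xs = zs} u∈))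
    anti′ (there u∈)  (there v∈)      =
      anti (proj₁ (∈-filter⁻ ≰x? u∈)) (proj₁ (∈-filter⁻ ≰x? v∈))

    keep : ∀ {y} → Any (y ≤ₒ_) zs → Any (y ≤ₒ_) (x ∷ zs′)
    keep {y} y≤zs with filter⁺ ≰x? y≤zs
    ... | inj₁ y≤zs′ = there y≤zs′
    ... | inj₂ ¬≰x with Any.lookup y≤zs ≤? x
    -- A bound of `y` lost to the filter lies below `x`, so `x` takes over as a bound. Decidability
    -- removes the double negation.
    ...   | yes z≤x = here (≤ₒ-trans (lookup-result y≤zs) z≤x)
    ...   | no  z≰x = contradiction z≰x ¬≰x

-- Down-sets of ℕⁿ.

punchIn-elim : (P : Pred (Fin (suc n)) ℓ) (i : Fin (suc n)) →
               P i → (∀ k → P (punchIn i k)) → ∀ j → P j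
punchIn-elim             P Fin.zero    pi ps Fin.zero    = pi
punchIn-elim             P Fin.zero    pi ps (Fin.suc j) = ps j
punchIn-elim {n = suc _} P (Fin.suc i) pi ps Fin.zero    = ps Fin.zero
punchIn-elim {n = suc _} P (Fin.suc i) pi ps (Fin.suc j) =
  punchIn-elim (P ∘ Fin.suc) i pi (ps ∘ Fin.suc) j

infix 4 _≤ᵥ_ _◁_

_≤ᵥ_ : Vector ℕ n → Vector ℕ n → Set
_≤ᵥ_ = Pointwise _≤_

_◁_ : Vector ℕ n → Vector U n → Set
_◁_ = Pointwise (λ m u → [ m ] ≤⁺ u)

DownClosed : Pred (Vector ℕ n) ℓ → Set ℓ
DownClosed D = ∀ {p q} → p ≤ᵥ q → D q → D p

-- For a down-closed `D` this is the slice at `j` in direction `i`. The inequalities to a witness in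
-- `D` make it down-closed by transitivity alone, without rebuilding a vector from `j` and `r`.
slice : Pred (Vector ℕ (suc n)) ℓ → Fin (suc n) → ℕ → Pred (Vector ℕ n) ℓ
slice D i j r = ∃ λ q → D q × j ≤ q i × (r ≤ᵥ q ∘ punchIn i)

slice-downClosed : (D : Pred (Vector ℕ (suc n)) ℓ) → ∀ i j →
                   DownClosed (slice D i j)
slice-downClosed D i j p≤r (q , Dq , j≤qi , r≤q) =
  q , Dq , j≤qi , λ k → ≤-trans (p≤r k) (r≤q k)

◁-insertAt⁺ : (q : Vector ℕ (suc n)) (β : Vector U n) (i : Fin (suc n)) {u : U} →
              [ q i ] ≤⁺ u → q ∘ punchIn i ◁ β → q ◁ insertAt β i u
◁-insertAt⁺ q β i {u} qi≤u q◁β = punchIn-elim _ i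
  (subst ([ q i ] ≤⁺_) (sym (insertAt-lookup β i u)) qi≤u)
  (λ k → subst ([ q (punchIn i k) ] ≤⁺_) (sym (insertAt-punchIn β i u k)) (q◁β k))

◁-insertAt⁻ : (q : Vector ℕ (suc n)) (β : Vector U n) (i : Fin (suc n)) {u : U} →
              q ◁ insertAt β i u → [ q i ] ≤⁺ u × (q ∘ punchIn i ◁ β)
◁-insertAt⁻ q β i {u} q◁ =
  subst ([ q i ] ≤⁺_) (insertAt-lookup β i u) (q◁ i) ,
  λ k → subst ([ q (punchIn i k) ] ≤⁺_) (insertAt-punchIn β i u k) (q◁ (punchIn i k))

module _ (em : ExcludedMiddle ℓ) where

  downClosed⇒finitelyGenerated : (D : Pred (Vector ℕ n) ℓ) → DownClosed D →
    ∃ λ βs → D ≐ (λ q → Any (q ◁_) βs)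
  downClosed⇒finitelyGenerated D down with em {P = ∃ λ p → ¬ D p}
  downClosed⇒finitelyGenerated D down | no ∄p∉D =
    (λ _ → ⊤⁺) ∷ [] ,
    (λ _ → here (λ _ → _ ≤⊤⁺)) ,
    (λ {q} _ → em⇒dne em (λ q∉D → ∄p∉D (q , q∉D)))
  -- Any two vectors of length zero are related by `_≤ᵥ_`, so one point outside `D` leaves `D`
  -- empty.
  downClosed⇒finitelyGenerated {n = zero} D down | yes (p , p∉D) =
    [] , (λ Dq → contradiction (down (λ ()) Dq) p∉D) , (λ ())
  downClosed⇒finitelyGenerated {n = suc n} D down | yes (p , p∉D) =
    concat (tabulate γs) , complete , sound
    where
    generated : ∀ i j → ∃ λ βs → slice D i j ≐ (λ q → Any (q ◁_) βs)
    generated i j = downClosed⇒finitelyGenerated (slice D i j) (slice-downClosed D i j)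

    -- These generators also bound points with `q i` smaller than `j`. That is harmless: such points
    -- lie below a point of `D`, as `sound` uses.
    βs : Fin (suc n) → ℕ → List (Vector U (suc n))
    βs i j = List.map (λ β → insertAt β i [ j ]) (proj₁ (generated i j))

    γs : Fin (suc n) → List (Vector U (suc n))
    γs i = concat (applyUpTo (βs i) (p i))

    complete : ∀ {q} → D q → Any (q ◁_) (concat (tabulate γs))
    complete {q} Dq with any? (λ i → q i <? p i)
    -- Here `p ≤ᵥ q`, so `p` would belong to `D`.
    ... | no  q≮p         =
      contradiction (down (λ i → ≮⇒≥ (λ qi<pi → q≮p (i , qi<pi))) Dq) p∉D
    ... | yes (i , qi<pi) =
      concat⁺ (tabulate⁺ {f = γs} i (concat⁺ (applyUpTo⁺ (βs i) q◁βs qi<pi)))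
      where
      q◁βs : Any (q ◁_) (βs i (q i))
      -- `q` is its own witness for the slice at height `q i`.
      q◁βs = map⁺ (Any.map (λ {β} → ◁-insertAt⁺ q β i [ ≤-refl ])
        (proj₁ (proj₂ (generated i (q i))) (q , Dq , ≤-refl , λ _ → ≤-refl)))

    sound : ∀ {q} → Any (q ◁_) (concat (tabulate γs)) → D q
    sound {q} q◁
      with i , q◁ᵢ ← tabulate⁻ {f = γs} (concat⁻ (tabulate γs) q◁)
      with j , _ , q◁ⱼ ← applyUpTo⁻ (βs i) (concat⁻ (applyUpTo (βs i) (p i)) q◁ᵢ)
      with β , β∈ , q◁β ← find (map⁻ q◁ⱼ)
      with [ qi≤j ] , r◁β ← ◁-insertAt⁻ q β i q◁β
      with q′ , Dq′ , j≤q′i , r≤q′ ← proj₂ (proj₂ (generated i j)) (lose β∈ r◁β)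
      = down (punchIn-elim _ i (≤-trans qi≤j j≤q′i) r≤q′) Dq′

-- Arities with zero and with nonzero first component.

suc⁺ : U → U
suc⁺ [ k ] = [ suc k ]
suc⁺ ⊤⁺    = ⊤⁺

constraint : Vector U 2 → 𝓐
constraint u = ⟦ [ 0 ] , u 0F , u 1F ⟧

-- `suc⁺` maps `U` onto its nonzero elements, so the finite arities with nonempty head become a full
-- copy of ℕ³.
nonConstraint : Vector U 3 → 𝓐
nonConstraint u = ⟦ suc⁺ (u 0F) , u 1F , u 2F ⟧

suc⁺-mono : ∀ {u v} → u ≤⁺ v → suc⁺ u ≤⁺ suc⁺ v
suc⁺-mono [ k≤l ] = [ s≤s k≤l ]
suc⁺-mono (k ≤⊤⁺) = suc⁺ k ≤⊤⁺

suc⁺-cancel : ∀ {u v} → suc⁺ u ≤⁺ suc⁺ v → u ≤⁺ v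
suc⁺-cancel {[ _ ]} {[ _ ]} [ k≤l ] = [ s≤s⁻¹ k≤l ]
suc⁺-cancel {⊤⁺}    {[ _ ]} ()
suc⁺-cancel {u}     {⊤⁺}    _       = u ≤⊤⁺

suc⁺≢0 : ∀ u → ¬ suc⁺ u ≡ [ 0 ]
suc⁺≢0 [ _ ] ()
suc⁺≢0 ⊤⁺    ()

suc⁺≰0 : ∀ u → ¬ suc⁺ u ≤⁺ [ 0 ]
suc⁺≰0 [ _ ] [ () ]
suc⁺≰0 ⊤⁺    ()

constraint-mono : ∀ {u v} → Pointwise _≤⁺_ u v → constraint u ≼ constraint v
constraint-mono u≤v = record
  { ≤₁ = [ ≤-refl ] ; ≤₂ = u≤v 0F ; ≤₃ = u≤v 1F ; 0⇒0 = id }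

constraint-cancel : ∀ {u v} → constraint u ≼ constraint v → Pointwise _≤⁺_ u v
constraint-cancel cu≼cv 0F = _≼_.≤₂ cu≼cv
constraint-cancel cu≼cv 1F = _≼_.≤₃ cu≼cv

nonConstraint-mono : ∀ {u v} → Pointwise _≤⁺_ u v →
                     nonConstraint u ≼ nonConstraint v
nonConstraint-mono {u} u≤v = record
  { ≤₁ = suc⁺-mono (u≤v 0F) ; ≤₂ = u≤v 1F ; ≤₃ = u≤v 2F
  ; 0⇒0 = λ eq → contradiction eq (suc⁺≢0 (u 0F)) }

nonConstraint-cancel : ∀ {u v} → nonConstraint u ≼ nonConstraint v →
                       Pointwise _≤⁺_ u v
nonConstraint-cancel nu≼nv 0F = suc⁺-cancel (_≼_.≤₁ nu≼nv)
nonConstraint-cancel nu≼nv 1F = _≼_.≤₂ nu≼nv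
nonConstraint-cancel nu≼nv 2F = _≼_.≤₃ nu≼nv

-- The components alone would allow this relation; only the clause `0⇒0` excludes it.
constraint⋠nonConstraint : ∀ u v → ¬ constraint u ≼ nonConstraint v
constraint⋠nonConstraint u v c≼n = suc⁺≢0 (v 0F) (_≼_.0⇒0 c≼n refl)

nonConstraint⋠constraint : ∀ u v → ¬ nonConstraint u ≼ constraint v
nonConstraint⋠constraint u v n≼c = suc⁺≰0 (u 0F) (_≼_.≤₁ n≼c)

-- Down-closures in `𝓐` and the classes `𝓕`.

↓_ : Pred 𝓐 ℓ → Pred 𝓐 ℓ
(↓ Δ) α = ∃ λ β → Δ β × α ≼ β

↓-downClosed : (Δ : Pred 𝓐 ℓ) → ∀ {α β} → α ≼ β → (↓ Δ) β → (↓ Δ) α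
↓-downClosed Δ α≼β (γ , Δγ , β≼γ) = γ , Δγ , Poset.trans ≼-poset α≼β β≼γ

-- The equivalence cannot extend to infinite components: for Δ = {[k,0,0] | k ≥ 1}
-- some point of xs lies above [∞,0,0], which is not in ↓ Δ.
↓-finitelyGenerated : ExcludedMiddle ℓ → (Δ : Pred 𝓐 ℓ) →
  ∃ λ xs → ∀ k m n → let α = ⟦ [ k ] , [ m ] , [ n ] ⟧ in
    (↓ Δ) α ⇔ Any (α ≼_) xs
↓-finitelyGenerated em Δ
  with βs , c⊆ , ⊆c ← downClosed⇒finitelyGenerated em
         (λ q → (↓ Δ) (constraint ([_] ∘ q)))
         (λ p≤q → ↓-downClosed Δ (constraint-mono (λ i → [ p≤q i ])))
     | γs , n⊆ , ⊆n ← downClosed⇒finitelyGenerated em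
         (λ q → (↓ Δ) (nonConstraint ([_] ∘ q)))
         (λ p≤q → ↓-downClosed Δ (nonConstraint-mono (λ i → [ p≤q i ])))
  = List.map constraint βs ++ List.map nonConstraint γs , λ where
    -- In both cases the encoded vector computes to `α`, and the summand of the other kind is
    -- excluded by incomparability.
    zero m n → let q = fromList (m ∷ n ∷ []) in mk⇔
      (λ α∈↓Δ → ++⁺ˡ (map⁺ (Any.map constraint-mono (c⊆ {q} α∈↓Δ))))
      ([ (λ α≼ → ⊆c {q} (Any.map constraint-cancel (map⁻ α≼)))
       , (λ α≼ → contradiction (Any.satisfied (map⁻ α≼))
                   (uncurry (constraint⋠nonConstraint ([_] ∘ q))))
       ]′ ∘ ++⁻ (List.map constraint βs))
    (suc k) m n → let q = fromList (k ∷ m ∷ n ∷ []) in mk⇔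
      (λ α∈↓Δ → ++⁺ʳ _ (map⁺ (Any.map nonConstraint-mono (n⊆ {q} α∈↓Δ))))
      ([ (λ α≼ → contradiction (Any.satisfied (map⁻ α≼))
                   (uncurry (nonConstraint⋠constraint ([_] ∘ q))))
       , (λ α≼ → ⊆n {q} (Any.map nonConstraint-cancel (map⁻ α≼)))
       ]′ ∘ ++⁻ (List.map constraint βs))

theorem3 : ExcludedMiddle 0ℓ →
    (At : Set) → At ↔ ℕ →
    (Δ : Pred 𝓐 0ℓ) →
    ∃ λ (Δ′ : Pred 𝓐 0ℓ) →
    IsFiniteSet Δ′ × IsAntichain ≼-poset Δ′ × 𝓕 At Δ ≐ 𝓕 At Δ′
theorem3 em At _ Δ
  with xs , ↓Δ⇔xs ← ↓-finitelyGenerated em Δ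
  -- Excluded middle serves as the decision procedure for `_≼_`.
  with zs , anti , xs⇔zs ← antichain-of-maximal ≼-poset (λ _ _ → em) xs
  = (_∈ zs) , (zs , id , id) , anti ,
    (λ (fin , P⊆Δ) → fin , λ r r∈P → find (Equivalence.to (↓Δ⇔zs r) (P⊆Δ r r∈P))) ,
    (λ (fin , P⊆zs) → fin , λ r r∈P → let α , α∈zs , r≼α = P⊆zs r r∈P in
      Equivalence.from (↓Δ⇔zs r) (lose α∈zs r≼α))
  where
  -- Arities of rules have finite components, so the equivalence at finite points suffices.
  ↓Δ⇔zs : (r : Rule At) → (↓ Δ) (arity r) ⇔ Any (arity r ≼_) zs
  ↓Δ⇔zs r = mk⇔
    (Equivalence.to (xs⇔zs _) ∘ Equivalence.to (↓Δ⇔xs _ _ _))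
    (Equivalence.from (↓Δ⇔xs _ _ _) ∘ Equivalence.from (xs⇔zs _))
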